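{- For all $m\geq 1$ and $n\in\mathbb N$, \[ s_{n,m}(122,123)=\frac{1}{mn+1}\binom{(m+1)n}{n}. \]
   Context: $[n]_m=\{1^m,\ldots,n^m\}$; a permutation of $[n]_m$ is a sequence of length $nm$ in which each element of $[n]$ appears exactly $m$ times (for $n=0$ only the empty sequence). A sequence avoids a pattern $\pi$ if it has no subsequence order-isomorphic to $\pi$ (same relative order and same equalities among entries). $s_{n,m}(\Pi)$ is the number of permutations of $[n]_m$ avoiding all patterns in $\Pi$. -}

module Defs where

open import Data.Fin as Fin using (Fin)
open import Data.Fin.Properties as Finₚ using (all?)
open import Data.List using (List; []; _∷_; length; filter; zip; allFin; cartesianProductWith)
open import Data.List.Relation.Binary.Sublist.Propositional using (_⊆_; []; _∷_; _∷ʳ_)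
open import Data.List.Relation.Unary.All as All using (All)
open import Data.List.Relation.Unary.AllPairs using (AllPairs; allPairs?)
open import Data.Nat using (ℕ; zero; suc; _*_; _<_; _≟_; _<?_)
open import Data.Product using (∃-syntax; _×_; _,_)
open import Data.Sum using (_⊎_; inj₁; inj₂)
open import Function.Base using (_∘_)
open import Function.Bundles using (_⇔_; Equivalence; mk⇔)
open import Relation.Binary.PropositionalEquality using (_≡_; refl)
open import Relation.Nullary using (¬_; Dec; ¬?; _×-dec_; _→-dec_; _⊎-dec_)
open import Relation.Nullary.Decidable using (map′)
open import Relation.Unary using (Decidable)

-- The set [n] is modelled by Fin n, so letters are numbered from 0.
Word : ℕ → Set
Word n = List (Fin n)

Pattern : Set
Pattern = List ℕ

occurrences : ∀ {n} → Fin n → Word n → ℕ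
occurrences a w = length (filter (a Finₚ.≟_) w)

IsMultipermutation : (n m : ℕ) → Word n → Set
IsMultipermutation n m w = length w ≡ n * m × (∀ a → occurrences a w ≡ m)

SameComparison : ∀ {n} → Fin n × ℕ → Fin n × ℕ → Set
SameComparison (a , p) (b , q) = (a Fin.< b ⇔ p < q) × (a ≡ b ⇔ p ≡ q)

-- AllPairs ranges over positions i < j only. By trichotomy, agreement on
-- _<_ and _≡_ there gives agreement on _>_ as well.
_≅_ : ∀ {n} → Word n → Pattern → Set
w ≅ π = length w ≡ length π × AllPairs SameComparison (zip w π)

Contains : ∀ {n} → Pattern → Word n → Set
Contains π w = ∃[ v ] v ⊆ w × v ≅ π

Avoids : ∀ {n} → Pattern → Word n → Set
Avoids π w = ¬ Contains π w

AvoidsAll : ∀ {n} → List Pattern → Word n → Set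
AvoidsAll Π w = All (λ π → Avoids π w) Π

infix 4 _⇔-dec_

_⇔-dec_ : ∀ {A B : Set} → Dec A → Dec B → Dec (A ⇔ B)
a? ⇔-dec b? = map′ (λ (f , g) → mk⇔ f g)
                   (λ e → Equivalence.to e , Equivalence.from e)
                   ((a? →-dec b?) ×-dec (b? →-dec a?))

isMultipermutation? : ∀ n m → Decidable (IsMultipermutation n m)
isMultipermutation? n m w =
  (length w ≟ n * m) ×-dec all? (λ a → occurrences a w ≟ m)

sameComparison? : ∀ {n} (x y : Fin n × ℕ) → Dec (SameComparison x y)
sameComparison? (a , p) (b , q) =
  ((a Finₚ.<? b) ⇔-dec (p <? q)) ×-dec ((a Finₚ.≟ b) ⇔-dec (p ≟ q))

_≅?_ : ∀ {n} (w : Word n) (π : Pattern) → Dec (w ≅ π)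
w ≅? π = (length w ≟ length π) ×-dec allPairs? sameComparison? (zip w π)

module _ {A : Set} where

  someSublist? : {P : List A → Set} → Decidable P → ∀ w → Dec (∃[ v ] v ⊆ w × P v)
  someSublist? P? [] = map′ (λ p → [] , [] , p) (λ { (_ , [] , p) → p }) (P? [])
  someSublist? {P} P? (x ∷ w) =
    map′ to from (someSublist? (P? ∘ (x ∷_)) w ⊎-dec someSublist? P? w)
    where
    to : (∃[ v ] v ⊆ w × P (x ∷ v)) ⊎ (∃[ v ] v ⊆ w × P v) → ∃[ v ] v ⊆ x ∷ w × P v
    to (inj₁ (v , s , p)) = x ∷ v , refl ∷ s , p
    to (inj₂ (v , s , p)) = v , x ∷ʳ s , p

    from : ∃[ v ] v ⊆ x ∷ w × P v → (∃[ v ] v ⊆ w × P (x ∷ v)) ⊎ (∃[ v ] v ⊆ w × P v)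
    from (_ , refl ∷ s , p) = inj₁ (_ , s , p)
    from (v , _ ∷ʳ s , p)   = inj₂ (v , s , p)

avoidsAll? : ∀ {n} (Π : List Pattern) → Decidable (AvoidsAll {n} Π)
avoidsAll? Π w = All.all? (λ π → ¬? (someSublist? (_≅? π) w)) Π

-- All words of length k over Fin n, each listed exactly once.
words : (n k : ℕ) → List (Word n)
words n zero    = [] ∷ []
words n (suc k) = cartesianProductWith _∷_ (allFin n) (words n k)

multipermutations : (n m : ℕ) → List (Word n)
multipermutations n m = filter (isMultipermutation? n m) (words n (n * m))

s : (n m : ℕ) → List Pattern → ℕ
s n m Π = length (filter (avoidsAll? Π) (multipermutations n m))

module Submission where

{- A word avoids 122 and 123 iff after each letter a the letters greater than a strictly
   decrease.  Reading such a word from left to right, and writing l for the least letter met so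
   far, the unread part consists of all m copies of each letter below l, some copies of l, and a
   set Q of letters above l, one copy each, which have to appear in decreasing order.  The next
   letter is therefore max Q, or l, or, once at most one copy of l is left, a smaller letter.
   Only the size of Q matters, and the number of ways to go on satisfies the recursion that
   counts the continuations of a lattice path from (0,0) to (mn,n) in the region m y ≤ x.  The
   initial parts of these paths are counted by ballot numbers.  Summing, over one column, the
   products of both counts gives a value that does not depend on the column; in the last
   column it is the Fuss–Catalan number. -}

open import Defs
open import Data.Empty using (⊥)
open import Data.Fin as Fin using (Fin; toℕ; fromℕ<)
import Data.Fin.Properties as Fin
open import Data.Integer using (+_)
open import Data.Integer as ℤ using (ℤ)
import Data.Integer.Properties as ℤ
import Data.Integer.Tactic.RingSolver as ℤSolver
open import Data.List using (_∷_; [])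
open import Data.List using (List; _++_; [_]; length; map; replicate; filter)
open import Data.List.Membership.Propositional using (_∈_)
open import Data.List.Membership.Propositional.Properties
  using ( ∈-++⁺ˡ; ∈-++⁺ʳ; ∈-++⁻; ∈-map⁺; ∈-map⁻; ∈-∃++; ∈-filter⁺; ∈-filter⁻; ∈-allFin
        ; ∈-cartesianProductWith⁺)
open import Data.List.Membership.Propositional.Properties.WithK using (unique∧set⇒bag)
open import Data.List.Properties
  using ( ++-assoc; ∷-injective; ∷-injectiveʳ; map-injective; length-map; length-++
        ; length-replicate; filter-++; filter-all; filter-none; filter-accept; filter-reject)
open import Data.List.Relation.Binary.BagAndSetEquality using (∼bag⇒↭)
open import Data.List.Relation.Binary.Permutation.Propositional
  using (_↭_; ↭⇒↭ₛ; ↭-refl; ↭-sym; ↭-trans; ↭-reflexive; prep)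
open import Data.List.Relation.Binary.Permutation.Propositional.Properties
  using ( shift; drop-∷; ∈-resp-↭; All-resp-↭; ↭-empty-inv; ++-identityʳ; filter-↭; ↭-length
        ; map⁺)
import Data.List.Relation.Binary.Permutation.Setoid.Properties as Permutationₛ
open import Data.List.Relation.Binary.Sublist.Propositional
  using (_⊆_; _∷_; _∷ʳ_; from∈; to∈)
open import Data.List.Relation.Unary.All as All using (All; []; _∷_)
import Data.List.Relation.Unary.All.Properties as All
open import Data.List.Relation.Unary.AllPairs as AllPairs using (AllPairs; []; _∷_)
import Data.List.Relation.Unary.AllPairs.Properties as AllPairs
open import Data.List.Relation.Unary.Any using (here; there)
open import Data.List.Relation.Unary.Unique.Propositional using (Unique)
import Data.List.Relation.Unary.Unique.Propositional.Properties as Unique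
open import Data.Nat using (ℕ; suc; _+_; _*_; _≥_)
open import Data.Nat using (zero; _≤_; _<_; _>_; _≟_; z≤n; s≤s)
open import Data.Nat.Combinatorics using (_C_)
open import Data.Nat.Combinatorics using (nCk+nC[k+1]≡[n+1]C[k+1]; nC1≡n)
open import Data.Nat.Properties
  using ( ≤-refl; <-trans; <-asym; ≤-<-trans; <⇒≤; <⇒≢; <⇒≯; <⇒≱; ≤⇒≯; n≮n; n<1+n; n≤1+n
        ; m≤n⇒m≤1+n; m<n⇒m<1+n; m≤n⇒m<n∨m≡n; m<1+n⇒m<n∨m≡n; suc-injective
        ; +-comm; +-suc; +-identityʳ; +-cancelʳ-≡
        ; *-comm; *-suc; *-zeroʳ; *-identityʳ; *-distribʳ-+; *-cancelˡ-≡)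
import Data.Nat.Tactic.RingSolver as ℕSolver
open import Data.Product using (∃-syntax; _×_; _,_; proj₁; proj₂)
open import Data.Rational using (_/_) renaming (_*_ to _*ℚ_)
open import Data.Rational using (fromℚᵘ)
import Data.Rational.Properties as ℚ
open import Data.Rational.Unnormalised as ℚᵘ using (mkℚᵘ; *≡*)
import Data.Rational.Unnormalised.Properties as ℚᵘ
open import Data.Sum using (_⊎_; inj₁; inj₂)
open import Data.Unit using (⊤; tt)
open import Function.Base using (_∘_; const)
open import Function.Bundles using (mk⇔; Equivalence)
open import Relation.Binary.Definitions using (tri<; tri≈; tri>)
open import Relation.Binary.PropositionalEquality using (_≡_)
open import Relation.Binary.PropositionalEquality
  using (_≢_; refl; sym; trans; cong; cong₂; subst; resp₂; setoid; module ≡-Reasoning)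
open import Relation.Nullary using (yes; no; contradiction)

-- Admissible words and decreasing leftovers.

-- For a later `y ≤ a` the conclusion `y < x` is automatic, so only the letters above `a` are
-- constrained.
DecreasingAbove : ℕ → List ℕ → Set
DecreasingAbove a = AllPairs (λ x y → a < x → y < x)

Admissible : List ℕ → Set
Admissible []      = ⊤
Admissible (a ∷ w) = DecreasingAbove a w × Admissible w

decreasingAbove-mono : ∀ {a b w} → a ≤ b → DecreasingAbove a w → DecreasingAbove b w
decreasingAbove-mono a≤b = AllPairs.map (λ f b<x → f (≤-<-trans a≤b b<x))

-- Under the gap hypothesis every pair constrained at `a` is already constrained at `b`. This lets
-- the bound drop from `suc l` to `l` once no `suc l` is left.
decreasingAbove-gap : ∀ {a b w} → (∀ {x} → x ∈ w → a < x → b < x) →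
                      DecreasingAbove b w → DecreasingAbove a w
decreasingAbove-gap gap []       = []
decreasingAbove-gap gap (p ∷ ps) =
  All.map (λ f a<x → f (gap (here refl) a<x)) p ∷ decreasingAbove-gap (gap ∘ there) ps

decreasingAbove-max : ∀ {a w} → All (_≤ a) w → DecreasingAbove a w
decreasingAbove-max []          = []
decreasingAbove-max (x≤a ∷ w≤a) =
  All.map (λ _ a<x → contradiction a<x (≤⇒≯ x≤a)) w≤a ∷ decreasingAbove-max w≤a

Head≤ : ℕ → List ℕ → Set
Head≤ a w = ∃[ x ] ∃[ v ] w ≡ x ∷ v × x ≤ a

-- Letters above `a` are also above the head, so what admissibility demands at the head suffices.
head≤⇒decreasingAbove : ∀ {a w} → Head≤ a w → Admissible w → DecreasingAbove a w
head≤⇒decreasingAbove (x , v , refl , x≤a) (dec , _) =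
  All.universal (λ _ a<x → contradiction a<x (≤⇒≯ x≤a)) v ∷ decreasingAbove-mono x≤a dec

-- A set of letters above `a`, represented by the one order in which they can still be read; the
-- head is the maximum.
Leftovers : ℕ → List ℕ → Set
Leftovers a Q = All (a <_) Q × AllPairs _>_ Q

leftovers-∷⁻ : ∀ {a q Q} → Leftovers a (q ∷ Q) → Leftovers a Q
leftovers-∷⁻ (_ ∷ a<Q , _ ∷ Q↘) = a<Q , Q↘

leftovers-pred : ∀ {a Q} → Leftovers (suc a) Q → Leftovers a Q
leftovers-pred (a<Q , Q↘) = All.map (<-trans (n<1+n _)) a<Q , Q↘

leftovers-∷ʳ : ∀ {a Q} → Leftovers (suc a) Q → Leftovers a (Q ++ [ suc a ])
leftovers-∷ʳ lQ@(a<Q , Q↘) =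
    All.++⁺ (proj₁ (leftovers-pred lQ)) (n<1+n _ ∷ [])
  , AllPairs.++⁺ Q↘ ([] ∷ []) (All.map (λ a<x → a<x ∷ []) a<Q)

leftovers⇒decreasing : ∀ {a b Q} → Leftovers a Q → DecreasingAbove b Q
leftovers⇒decreasing (_ , Q↘) = AllPairs.map (λ x>y _ → x>y) Q↘

leftovers⇒admissible : ∀ {a Q} → Leftovers a Q → Admissible Q
leftovers⇒admissible {Q = []}     _  = tt
leftovers⇒admissible {Q = q ∷ Q}  lQ =
  leftovers⇒decreasing (leftovers-∷⁻ lQ) , leftovers⇒admissible (leftovers-∷⁻ lQ)

-- If `x` were another leftover, `q` would come after it, and `a < x` would force `q < x` although
-- `q` is the maximum.
head-leftover : ∀ {a x q w Q R} → Leftovers a (q ∷ Q) → x ∷ w ↭ q ∷ R →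
                DecreasingAbove a (x ∷ w) → x ∈ q ∷ Q → x ≡ q
head-leftover _ _ _ (here x≡q) = x≡q
head-leftover (_ ∷ a<Q , Q<q ∷ _) w↭ (x>w ∷ _) (there x∈Q) with ∈-resp-↭ (↭-sym w↭) (here refl)
... | here q≡x  = sym q≡x
... | there q∈w =
  contradiction (All.lookup x>w q∈w (All.lookup a<Q x∈Q)) (<⇒≯ (All.lookup Q<q x∈Q))

leftovers-unique : ∀ {a w Q} → Leftovers a Q → w ↭ Q → DecreasingAbove a w → w ≡ Q
leftovers-unique {w = []}    {[]}    _  _  _ = refl
leftovers-unique {w = x ∷ w} {[]}    _  w↭ _ with () ← ↭-empty-inv w↭
leftovers-unique {w = []}    {q ∷ Q} _  w↭ _ with () ← ↭-empty-inv (↭-sym w↭)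
leftovers-unique {w = x ∷ w} {q ∷ Q} lQ w↭ dec@(_ ∷ dec′)
  with refl ← head-leftover lQ w↭ dec (∈-resp-↭ w↭ (here refl))
  = cong (q ∷_) (leftovers-unique (leftovers-∷⁻ lQ) (drop-∷ w↭) dec′)

open ≡-Reasoning

-- Recursive enumeration of the admissible arrangements.

module Enumeration (k : ℕ) where

  copies : ℕ → List ℕ
  copies zero    = []
  copies (suc l) = replicate (suc k) l ++ copies l

  remaining : (l r : ℕ) → List ℕ
  remaining l r = replicate (suc r) l ++ copies l

  -- The index r stands for suc r unread copies of l.  The continuations in descending l r Q are
  -- those that begin with a letter ≤ l, where l need not have been met before.
  mutual
    completions : (l r : ℕ) → List ℕ → List (List ℕ)
    completions l r []      = descending l r []
    completions l r (q ∷ Q) = map (q ∷_) (completions l r Q) ++ descending l r (q ∷ Q)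

    descending : (l r : ℕ) → List ℕ → List (List ℕ)
    descending l       (suc r) Q = map (l ∷_) (completions l r Q)
    descending zero    zero    Q = [ 0 ∷ Q ]
    -- After the last `suc l` the unread letters above `l` are again those of `Q`, so
    -- `completions l k` fits although `l` has not been met. If instead a smaller letter comes
    -- first, the unread `suc l` becomes the least leftover.
    descending (suc l) zero    Q =
      map (suc l ∷_) (completions l k Q) ++ descending l k (Q ++ [ suc l ])

  -- No letter exceeds the greatest one, so at the start it can play the part of the least letter
  -- met, with no leftovers.
  arrangements : ℕ → List (List ℕ)
  arrangements zero    = [ [] ]
  arrangements (suc l) = completions l k []

  copies-< : ∀ l → All (_< l) (copies l)
  copies-< zero    = []
  copies-< (suc l) =
    All.++⁺ {xs = replicate (suc k) l} (All.replicate⁺ (suc k) (n<1+n l))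
            (All.map m<n⇒m<1+n (copies-< l))

  remaining-≤ : ∀ l r → All (_≤ l) (remaining l r)
  remaining-≤ l r =
    All.++⁺ (All.replicate⁺ (suc r) ≤-refl) (All.map <⇒≤ (copies-< l))

  -- Below l the two remaining letters l would complete a pattern 122.
  head≡l : ∀ {l r x w} Q → x ∷ w ↭ Q ++ remaining l (suc r) → Admissible (x ∷ w) →
           x ≤ l → x ≡ l
  head≡l {l} {r} {x} {w} Q w↭ (dec , _) x≤l with m≤n⇒m<n∨m≡n x≤l
  ... | inj₂ x≡l = x≡l
  -- At most one entry of `x ∷ w` equals `l`. As a symmetric condition on pairs, this passes to the
  -- rearrangement that begins with `l ∷ l`, where it fails.
  ... | inj₁ x<l = contradiction
    (Permutationₛ.AllPairs-resp-↭ (setoid ℕ) (λ f y≡l z≡l → f z≡l y≡l) (resp₂ _)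
                                  (↭⇒↭ₛ w↭l∷l) distinct)
    λ { ((notTwice ∷ _) ∷ _) → notTwice refl refl }
    where
    w↭l∷l : x ∷ w ↭ l ∷ l ∷ Q ++ replicate r l ++ copies l
    w↭l∷l = ↭-trans w↭ (↭-trans (shift l Q _) (prep l (shift l Q _)))

    distinct : AllPairs (λ y z → y ≡ l → z ≢ l) (x ∷ w)
    distinct = All.universal (λ _ x≡l → contradiction x≡l (<⇒≢ x<l)) w
             ∷ AllPairs.map (λ { f refl refl → n≮n _ (f x<l) }) dec

  ∈-content⁻ : ∀ {l r x} Q → x ∈ Q ++ remaining l r → x ∈ Q ⊎ x ≤ l
  ∈-content⁻ {l} {r} Q x∈ with ∈-++⁻ Q x∈
  ... | inj₁ x∈Q = inj₁ x∈Q
  ... | inj₂ x∈R = inj₂ (All.lookup (remaining-≤ l r) x∈R)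

  -- The leftovers exceed `suc l` and all other unread letters are at most `l`, so `suc l` does not
  -- occur in `w`.
  decreasingAbove-pred : ∀ {l w} Q → Leftovers (suc l) Q → w ↭ Q ++ remaining l k →
                         DecreasingAbove (suc l) w → DecreasingAbove l w
  decreasingAbove-pred {l} Q (l<Q , _) w↭ = decreasingAbove-gap gap
    where
    gap : ∀ {x} → x ∈ _ → l < x → suc l < x
    gap x∈w l<x with ∈-content⁻ Q (∈-resp-↭ w↭ x∈w)
    ... | inj₁ x∈Q = All.lookup l<Q x∈Q
    ... | inj₂ x≤l = contradiction l<x (≤⇒≯ x≤l)

  mutual
    -- `DecreasingAbove l` is carried through the induction because it is what allows `l` to be put
    -- in front.
    completions-sound : ∀ {l r Q w} → Leftovers l Q → w ∈ completions l r Q →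
      w ↭ Q ++ remaining l r × Admissible w × DecreasingAbove l w
    completions-sound {Q = []} lQ w∈ with w↭ , adm , hd ← descending-sound lQ w∈
      = w↭ , adm , head≤⇒decreasingAbove hd adm
    completions-sound {l} {r} {q ∷ Q} lQ@(l<q ∷ _ , Q<q ∷ _) w∈
      with ∈-++⁻ (map (q ∷_) (completions l r Q)) w∈
    ... | inj₂ w∈d with w↭ , adm , hd ← descending-sound lQ w∈d
      = w↭ , adm , head≤⇒decreasingAbove hd adm
    ... | inj₁ w∈m with v , v∈ , refl ← ∈-map⁻ (q ∷_) w∈m
                   with v↭ , adm , dec ← completions-sound (leftovers-∷⁻ lQ) v∈
      = prep q v↭
      , (AllPairs.map (λ f q<x → f (<-trans l<q q<x)) dec , adm)
      , All.map (λ v<q _ → v<q) v<q ∷ dec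
      where
      -- `q` is the greatest unread letter, so reading it first constrains nothing that follows.
      v<q : All (_< q) v
      v<q = All-resp-↭ (↭-sym v↭) (All.++⁺ Q<q
                        (All.map (λ x≤l → ≤-<-trans x≤l l<q) (remaining-≤ l r)))

    descending-sound : ∀ {l r Q w} → Leftovers l Q → w ∈ descending l r Q →
      w ↭ Q ++ remaining l r × Admissible w × Head≤ l w
    descending-sound {l} {suc r} {Q} lQ w∈ with v , v∈ , refl ← ∈-map⁻ (l ∷_) w∈
      with v↭ , adm , dec ← completions-sound lQ v∈
      = ↭-trans (prep l v↭) (↭-sym (shift l Q _)) , (dec , adm) , (l , v , refl , ≤-refl)
    descending-sound {zero} {zero} {Q} lQ (here refl) =
        ↭-trans (prep 0 (↭-sym (++-identityʳ Q))) (↭-sym (shift 0 Q []))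
      , (leftovers⇒decreasing lQ , leftovers⇒admissible lQ)
      , (0 , Q , refl , z≤n)
    descending-sound {suc l} {zero} {Q} lQ w∈ with ∈-++⁻ (map (suc l ∷_) (completions l k Q)) w∈
    ... | inj₁ w∈m with v , v∈ , refl ← ∈-map⁻ (suc l ∷_) w∈m
                   with v↭ , adm , dec ← completions-sound (leftovers-pred lQ) v∈
      = ↭-trans (prep (suc l) v↭) (↭-sym (shift (suc l) Q _))
      , (decreasingAbove-mono (n≤1+n l) dec , adm)
      , (suc l , v , refl , ≤-refl)
    ... | inj₂ w∈d
      with w↭ , adm , (x , v , w≡ , x≤l) ← descending-sound {r = k} (leftovers-∷ʳ lQ) w∈d
      = ↭-trans w↭ (↭-reflexive (++-assoc Q [ suc l ] (remaining l k)))
      , adm , (x , v , w≡ , m≤n⇒m≤1+n x≤l)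

  mutual
    -- The first letter selects the branch: a leftover has to be the greatest one by
    -- `head-leftover`, and any other letter is at most `l`.
    completions-complete : ∀ {l r Q w} → Leftovers l Q → w ↭ Q ++ remaining l r →
      Admissible w → DecreasingAbove l w → w ∈ completions l r Q
    completions-complete {Q = []} {w = []} lQ w↭ _ _ with () ← ↭-empty-inv (↭-sym w↭)
    completions-complete {Q = _ ∷ _} {w = []} lQ w↭ _ _ with () ← ↭-empty-inv (↭-sym w↭)
    completions-complete {Q = []} {w = x ∷ w} lQ w↭ adm _
      with ∈-content⁻ [] (∈-resp-↭ w↭ (here refl))
    ... | inj₂ x≤l = descending-complete lQ w↭ adm (x , w , refl , x≤l)
    completions-complete {l} {r} {q ∷ Q} {x ∷ w} lQ w↭ adm dec
      with ∈-content⁻ (q ∷ Q) (∈-resp-↭ w↭ (here refl))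
    ... | inj₂ x≤l = ∈-++⁺ʳ (map (q ∷_) (completions l r Q))
                            (descending-complete lQ w↭ adm (x , w , refl , x≤l))
    ... | inj₁ x∈Q with refl ← head-leftover lQ w↭ dec x∈Q
      = ∈-++⁺ˡ (∈-map⁺ (q ∷_)
          (completions-complete (leftovers-∷⁻ lQ) (drop-∷ w↭) (proj₂ adm) (AllPairs.tail dec)))

    descending-complete : ∀ {l r Q w} → Leftovers l Q → w ↭ Q ++ remaining l r →
      Admissible w → Head≤ l w → w ∈ descending l r Q
    descending-complete {l} {suc r} {Q} lQ w↭ adm (x , v , refl , x≤l)
      with refl ← head≡l Q w↭ adm x≤l
      = ∈-map⁺ (l ∷_) (completions-complete lQ
          (drop-∷ (↭-trans w↭ (shift l Q _))) (proj₂ adm) (proj₁ adm))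
    descending-complete {zero} {zero} {Q} lQ w↭ adm (.0 , v , refl , z≤n)
      = here (cong (0 ∷_) (leftovers-unique lQ
          (drop-∷ (↭-trans w↭ (↭-trans (shift 0 Q []) (prep 0 (++-identityʳ Q))))) (proj₁ adm)))
    descending-complete {suc l} {zero} {Q} lQ w↭ adm@(dec , adm′) (x , v , refl , x≤)
      with m≤n⇒m<n∨m≡n x≤
    ... | inj₁ (s≤s x≤l) = ∈-++⁺ʳ (map (suc l ∷_) (completions l k Q))
      (descending-complete (leftovers-∷ʳ lQ)
        (↭-trans w↭ (↭-reflexive (sym (++-assoc Q [ suc l ] (remaining l k)))))
        adm (x , v , refl , x≤l))
    ... | inj₂ refl = ∈-++⁺ˡ (∈-map⁺ (suc l ∷_)
      (completions-complete (leftovers-pred lQ) v↭ adm′ (decreasingAbove-pred Q lQ v↭ dec)))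
      where
      v↭ : v ↭ Q ++ remaining l k
      v↭ = drop-∷ (↭-trans w↭ (shift (suc l) Q _))

  mutual
    -- Branches joined by `_++_` differ in the first letter: `q` exceeds `l`, whereas words of
    -- `descending l r` begin with a letter at most `l`.
    completions-unique : ∀ {l r Q} → Leftovers l Q → Unique (completions l r Q)
    completions-unique {r = r} {[]} lQ = descending-unique {r = r} lQ
    completions-unique {l} {r} {q ∷ Q} lQ@(l<q ∷ _ , _) =
      Unique.++⁺ (Unique.map⁺ ∷-injectiveʳ (completions-unique {r = r} (leftovers-∷⁻ lQ)))
                 (descending-unique {r = r} lQ) disjoint
      where
      disjoint : ∀ {w} → w ∈ map (q ∷_) (completions l r Q) × w ∈ descending l r (q ∷ Q) → ⊥
      disjoint (w∈m , w∈d) with v , _ , refl ← ∈-map⁻ (q ∷_) w∈m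
                           with _ , _ , (.q , .v , refl , q≤l) ← descending-sound {r = r} lQ w∈d
        = <⇒≱ l<q q≤l

    descending-unique : ∀ {l r Q} → Leftovers l Q → Unique (descending l r Q)
    descending-unique {l}     {suc r} lQ = Unique.map⁺ ∷-injectiveʳ (completions-unique {r = r} lQ)
    descending-unique {zero}  {zero}  lQ = [] ∷ []
    descending-unique {suc l} {zero} {Q} lQ =
      Unique.++⁺ (Unique.map⁺ ∷-injectiveʳ (completions-unique {r = k} (leftovers-pred lQ)))
                 (descending-unique {r = k} (leftovers-∷ʳ lQ)) disjoint
      where
      disjoint : ∀ {w} → w ∈ map (suc l ∷_) (completions l k Q) ×
                         w ∈ descending l k (Q ++ [ suc l ]) → ⊥
      disjoint (w∈m , w∈d) with v , _ , refl ← ∈-map⁻ (suc l ∷_) w∈m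
        with _ , _ , (_ , _ , refl , l<l) ← descending-sound {r = k} (leftovers-∷ʳ lQ) w∈d
        = n≮n l l<l

  arrangements-sound : ∀ n {w} → w ∈ arrangements n → w ↭ copies n × Admissible w
  arrangements-sound zero    (here refl) = ↭-refl , tt
  arrangements-sound (suc l) w∈ with w↭ , adm , _ ← completions-sound ([] , []) w∈ = w↭ , adm

  arrangements-complete : ∀ n {w} → w ↭ copies n → Admissible w → w ∈ arrangements n
  arrangements-complete zero    w↭ _ with refl ← ↭-empty-inv w↭ = here refl
  arrangements-complete (suc l) {w} w↭ adm =
    completions-complete ([] , []) w↭ adm
      (decreasingAbove-max (All-resp-↭ (↭-sym w↭) (remaining-≤ l k)))

  arrangements-unique : ∀ n → Unique (arrangements n)
  arrangements-unique zero    = [] ∷ []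
  arrangements-unique (suc l) = completions-unique {r = k} ([] , [])

  -- Counting the continuations.

  mutual
    -- With `L` letters above `l`, the state `l r q` is the lattice point in column
    -- `suc k * suc L - suc r` at height `L - q`. `completionCount` counts the path continuations
    -- from there, and `descendingCount` those whose next step is horizontal. The sum in the last
    -- clause is `completionCount l k (suc q)`: the next column is a multiple of `suc k` and admits
    -- one more unit of height.
    completionCount : (l r q : ℕ) → ℕ
    completionCount l r zero    = descendingCount l r zero
    completionCount l r (suc q) = completionCount l r q + descendingCount l r (suc q)

    descendingCount : (l r q : ℕ) → ℕ
    descendingCount l       (suc r) q = completionCount l r q
    descendingCount zero    zero    q = 1
    descendingCount (suc l) zero    q = completionCount l k q + descendingCount l k (suc q)

  mutual
    length-completions : ∀ l r Q → length (completions l r Q) ≡ completionCount l r (length Q)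
    length-completions l r []      = length-descending l r []
    length-completions l r (q ∷ Q) = begin
      length (map (q ∷_) (completions l r Q) ++ descending l r (q ∷ Q))
        ≡⟨ length-++ (map (q ∷_) (completions l r Q)) ⟩
      length (map (q ∷_) (completions l r Q)) + length (descending l r (q ∷ Q))
        ≡⟨ cong₂ _+_ (trans (length-map _ (completions l r Q)) (length-completions l r Q))
                     (length-descending l r (q ∷ Q)) ⟩
      completionCount l r (suc (length Q)) ∎

    length-descending : ∀ l r Q → length (descending l r Q) ≡ descendingCount l r (length Q)
    length-descending l       (suc r) Q =
      trans (length-map _ (completions l r Q)) (length-completions l r Q)
    length-descending zero    zero    Q = refl
    length-descending (suc l) zero    Q = begin
      length (map (suc l ∷_) (completions l k Q) ++ descending l k (Q ++ [ suc l ]))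
        ≡⟨ length-++ (map (suc l ∷_) (completions l k Q)) ⟩
      length (map (suc l ∷_) (completions l k Q)) + length (descending l k (Q ++ [ suc l ]))
        ≡⟨ cong₂ _+_ (trans (length-map _ (completions l k Q)) (length-completions l k Q))
                     (length-descending l k (Q ++ [ suc l ])) ⟩
      completionCount l k (length Q) + descendingCount l k (length (Q ++ [ suc l ]))
        ≡⟨ cong (λ q → completionCount l k (length Q) + descendingCount l k q)
                (trans (length-++ Q) (+-comm (length Q) 1)) ⟩
      completionCount l k (length Q) + descendingCount l k (suc (length Q)) ∎

-- Absorption identities for binomial coefficients.

-- The subtraction in the factor `n - k` is moved to the left side, so that `k > n` is covered too;
-- the induction is by Pascal's rule.
absorption : ∀ n k → suc k * (n C suc k) + k * (n C k) ≡ n * (n C k)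
absorption n zero = trans (solveˡ (n C 1)) (trans (nC1≡n n) (sym (*-identityʳ n)))
  where
  solveˡ : ∀ x → 1 * x + 0 * 1 ≡ x
  solveˡ = ℕSolver.solve-∀
absorption zero    (suc k) = cong₂ _+_ (*-zeroʳ (2 + k)) (*-zeroʳ (suc k))
absorption (suc n) (suc k) = begin
  (2 + k) * (suc n C (2 + k)) + suc k * (suc n C suc k)
    ≡⟨ cong₂ (λ u v → (2 + k) * u + suc k * v) (nCk+nC[k+1]≡[n+1]C[k+1] n (suc k))
                                                (nCk+nC[k+1]≡[n+1]C[k+1] n k) ⟨
  (2 + k) * (b + c) + suc k * (a + b)
    ≡⟨ regroup k a b c ⟩
  ((2 + k) * c + suc k * b) + (suc k * b + k * a) + (a + b)
    ≡⟨ cong₂ (λ u v → u + v + (a + b)) (absorption n (suc k)) (absorption n k) ⟩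
  n * b + n * a + (a + b)
    ≡⟨ collect n a b ⟩
  suc n * (a + b)
    ≡⟨ cong (suc n *_) (nCk+nC[k+1]≡[n+1]C[k+1] n k) ⟩
  suc n * (suc n C suc k) ∎
  where
  a = n C k
  b = n C suc k
  c = n C (2 + k)
  regroup : ∀ k a b c → (2 + k) * (b + c) + suc k * (a + b) ≡
                        ((2 + k) * c + suc k * b) + (suc k * b + k * a) + (a + b)
  regroup = ℕSolver.solve-∀
  collect : ∀ n a b → n * b + n * a + (a + b) ≡ suc n * (a + b)
  collect = ℕSolver.solve-∀

absorption′ : ∀ j k → suc k * ((j + k) C suc k) ≡ j * ((j + k) C k)
absorption′ j k = +-cancelʳ-≡ (k * ((j + k) C k)) _ _
  (trans (absorption (j + k) k) (*-distribʳ-+ ((j + k) C k) j k))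

-- Convolutions and partial sums.

convolution : (f g : ℕ → ℤ) → ℕ → ℤ
convolution f g zero    = f 0 ℤ.* g 0
convolution f g (suc n) = f 0 ℤ.* g (suc n) ℤ.+ convolution (f ∘ suc) g n

convolution-unfoldʳ : ∀ f g n →
  convolution f g (suc n) ≡ convolution f (g ∘ suc) n ℤ.+ f (suc n) ℤ.* g 0
convolution-unfoldʳ f g zero    = refl
convolution-unfoldʳ f g (suc n) =
  trans (cong (λ c → f 0 ℤ.* g (2 + n) ℤ.+ c) (convolution-unfoldʳ (f ∘ suc) g n))
        (sym (ℤ.+-assoc (f 0 ℤ.* g (2 + n)) _ _))

convolution-comm : ∀ f g n → convolution f g n ≡ convolution g f n
convolution-comm f g zero    = ℤ.*-comm (f 0) (g 0)
convolution-comm f g (suc n) = begin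
  f 0 ℤ.* g (suc n) ℤ.+ convolution (f ∘ suc) g n
    ≡⟨ cong₂ ℤ._+_ (ℤ.*-comm (f 0) (g (suc n))) (convolution-comm (f ∘ suc) g n) ⟩
  g (suc n) ℤ.* f 0 ℤ.+ convolution g (f ∘ suc) n
    ≡⟨ ℤ.+-comm (g (suc n) ℤ.* f 0) _ ⟩
  convolution g (f ∘ suc) n ℤ.+ g (suc n) ℤ.* f 0
    ≡⟨ convolution-unfoldʳ g f n ⟨
  convolution g f (suc n) ∎

-- A recurrence instead of an explicit sum, since this is the form in which `ballot` and
-- `completionCount` provide it.
record PartialSums (F f : ℕ → ℤ) : Set where
  field
    first : F 0 ≡ f 0
    next  : ∀ n → F (suc n) ≡ F n ℤ.+ f (suc n)
open PartialSums

partialSums-unique : ∀ {F G f} → PartialSums F f → PartialSums G f → ∀ n → F n ≡ G n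
partialSums-unique F G zero    = trans (first F) (sym (first G))
partialSums-unique F G (suc n) =
  trans (next F n) (trans (cong (ℤ._+ _) (partialSums-unique F G n)) (sym (next G n)))

-- For generating functions, taking partial sums is multiplication by `1/(1-z)`, which may be
-- applied to one factor of a product.
convolution-partialSumsʳ : ∀ f {G g} → PartialSums G g →
                           PartialSums (convolution f G) (convolution f g)
convolution-partialSumsʳ f     G .first = cong (f 0 ℤ.*_) (first G)
convolution-partialSumsʳ f {G} {g} ΣG .next zero = begin
  f 0 ℤ.* G 1 ℤ.+ f 1 ℤ.* G 0
    ≡⟨ cong₂ (λ u v → f 0 ℤ.* u ℤ.+ f 1 ℤ.* v) (next ΣG 0) (first ΣG) ⟩
  f 0 ℤ.* (G 0 ℤ.+ g 1) ℤ.+ f 1 ℤ.* g 0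
    ≡⟨ distrib (f 0) (G 0) (g 1) (f 1 ℤ.* g 0) ⟩
  f 0 ℤ.* G 0 ℤ.+ (f 0 ℤ.* g 1 ℤ.+ f 1 ℤ.* g 0) ∎
  where
  distrib : ∀ a b c d → a ℤ.* (b ℤ.+ c) ℤ.+ d ≡ a ℤ.* b ℤ.+ (a ℤ.* c ℤ.+ d)
  distrib = ℤSolver.solve-∀
convolution-partialSumsʳ f {G} {g} ΣG .next (suc n) = begin
  f 0 ℤ.* G (2 + n) ℤ.+ convolution (f ∘ suc) G (suc n)
    ≡⟨ cong₂ (λ u v → f 0 ℤ.* u ℤ.+ v) (next ΣG (suc n))
             (convolution-partialSumsʳ (f ∘ suc) ΣG .next n) ⟩
  f 0 ℤ.* (G (suc n) ℤ.+ g (2 + n)) ℤ.+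
    (convolution (f ∘ suc) G n ℤ.+ convolution (f ∘ suc) g (suc n))
    ≡⟨ distrib (f 0) (G (suc n)) (g (2 + n)) _ _ ⟩
  convolution f G (suc n) ℤ.+ convolution f g (2 + n) ∎
  where
  distrib : ∀ a b c d e → a ℤ.* (b ℤ.+ c) ℤ.+ (d ℤ.+ e) ≡ (a ℤ.* b ℤ.+ d) ℤ.+ (a ℤ.* c ℤ.+ e)
  distrib = ℤSolver.solve-∀

-- Both sides are the sum of `f i * g j` over `i + j ≤ n`; formally, both are partial sums of
-- `convolution f g`.
convolution-summation : ∀ {F f G g} → PartialSums F f → PartialSums G g →
                        ∀ n → convolution f G n ≡ convolution F g n
convolution-summation {F} {f} {G} {g} ΣF ΣG =
  partialSums-unique (convolution-partialSumsʳ f ΣG) record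
    { first = trans (convolution-comm F g 0) (trans (first Σˡ) (convolution-comm g f 0))
    ; next  = λ n → trans (convolution-comm F g (suc n)) (trans (next Σˡ n)
                          (cong₂ ℤ._+_ (convolution-comm g F n) (convolution-comm g f (suc n))))
    }
  where
  Σˡ = convolution-partialSumsʳ g ΣF

partialSums-convolution-1 : ∀ f → PartialSums (convolution f (const (+ 1))) f
partialSums-convolution-1 f .first  = ℤ.*-identityʳ (f 0)
partialSums-convolution-1 f .next n =
  trans (convolution-unfoldʳ f (const (+ 1)) n)
        (cong (λ c → convolution f (const (+ 1)) n ℤ.+ c) (ℤ.*-identityʳ (f (suc n))))

-- Ballot numbers and the sum over a column.

module Counting (k : ℕ) where

  open Enumeration k

  m = suc k

  -- For m * y ≤ x, ballot (suc x) y counts the lattice paths from (0,0) to (x,y) in the region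
  -- m * y ≤ x.  The recursion of the path counts holds for all x and y, but elsewhere the values
  -- count nothing and may be negative.
  ballot : ℕ → ℕ → ℤ
  ballot x zero    = + 1
  ballot x (suc y) = + ((x + y) C suc y) ℤ.- + m ℤ.* + ((x + y) C y)

  -- Pascal's rule in both binomials. For paths with `x > 0`, `ballot x` counts the arrivals in
  -- column `x` by a horizontal step, and vertical steps then lead up to the end point.
  ballot-partialSums : ∀ x → PartialSums (ballot (suc x)) (ballot x)
  ballot-partialSums x .first = refl
  ballot-partialSums x .next zero = begin
    + ((suc x + 0) C 1) ℤ.- + m ℤ.* + 1
      ≡⟨ cong (λ c → + c ℤ.- + m ℤ.* + 1) (trans (nC1≡n (suc x + 0)) (cong suc (sym (nC1≡n (x + 0))))) ⟩
    (+ 1 ℤ.+ + ((x + 0) C 1)) ℤ.- + m ℤ.* + 1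
      ≡⟨ ℤ.+-assoc (+ 1) (+ ((x + 0) C 1)) (ℤ.- (+ m ℤ.* + 1)) ⟩
    + 1 ℤ.+ (+ ((x + 0) C 1) ℤ.- + m ℤ.* + 1) ∎
  ballot-partialSums x .next (suc y) = begin
    + ((suc x + suc y) C (2 + y)) ℤ.- + m ℤ.* + ((suc x + suc y) C suc y)
      ≡⟨ cong₂ (λ u v → + u ℤ.- + m ℤ.* + v) (nCk+nC[k+1]≡[n+1]C[k+1] (x + suc y) (suc y))
                                             (nCk+nC[k+1]≡[n+1]C[k+1] (x + suc y) y) ⟨
    (+ b ℤ.+ + c) ℤ.- + m ℤ.* (+ a ℤ.+ + b)
      ≡⟨ regroup (+ m) (+ a) (+ b) (+ c) ⟩
    (+ b ℤ.- + m ℤ.* + a) ℤ.+ (+ c ℤ.- + m ℤ.* + b)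
      ≡⟨ cong (λ N → (+ (N C suc y) ℤ.- + m ℤ.* + (N C y)) ℤ.+ (+ c ℤ.- + m ℤ.* + b)) (+-suc x y) ⟩
    ballot (suc x) (suc y) ℤ.+ ballot x (2 + y) ∎
    where
    a = (x + suc y) C y
    b = (x + suc y) C suc y
    c = (x + suc y) C (2 + y)
    regroup : ∀ m a b c → (b ℤ.+ c) ℤ.- m ℤ.* (a ℤ.+ b) ≡ (b ℤ.- m ℤ.* a) ℤ.+ (c ℤ.- m ℤ.* b)
    regroup = ℤSolver.solve-∀

  -- The point at height `suc y` in column `m * suc y - 1` lies one column short of the region. By
  -- `absorption′` the two terms cancel.
  ballot-boundary : ∀ y → ballot (m * suc y) (suc y) ≡ + 0
  ballot-boundary y = begin
    + ((m * suc y + y) C suc y) ℤ.- + m ℤ.* + ((m * suc y + y) C y)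
      ≡⟨ cong₂ (λ u v → + u ℤ.- v) C≡ (sym (ℤ.pos-* m N)) ⟩
    + (m * N) ℤ.- + (m * N)
      ≡⟨ ℤ.+-inverseʳ (+ (m * N)) ⟩
    + 0 ∎
    where
    N = (m * suc y + y) C y
    rearrange : ∀ m y N → m * y * N ≡ y * (m * N)
    rearrange = ℕSolver.solve-∀
    C≡ : (m * suc y + y) C suc y ≡ m * N
    C≡ = *-cancelˡ-≡ _ _ (suc y) (trans (absorption′ (m * suc y) y) (rearrange m (suc y) N))

  -- With `a` and `b` as below, `absorption′` gives `suc (m * n) * a = n * b`, so the left side
  -- becomes `(m * n + 1) * b - m * n * b = b`.
  ballot-diagonal : ∀ n → + suc (m * n) ℤ.* ballot (suc (m * n)) n ≡ + (((m + 1) * n) C n)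
  ballot-diagonal zero = cong (λ N → + suc N ℤ.* + 1) (*-zeroʳ m)
  ballot-diagonal n@(suc j) = begin
    + suc (m * n) ℤ.* (+ b ℤ.- + m ℤ.* + a)
      ≡⟨ expand (+ suc (m * n)) (+ b) (+ m) (+ a) ⟩
    + suc (m * n) ℤ.* + b ℤ.- + m ℤ.* (+ suc (m * n) ℤ.* + a)
      ≡⟨ cong₂ (λ u v → (u ℤ.* + b) ℤ.- + m ℤ.* v) (cong (λ c → + 1 ℤ.+ c) (ℤ.pos-* m n))
           (trans (sym (ℤ.pos-* (suc (m * n)) a))
           (trans (cong +_ (sym (absorption′ (suc (m * n)) j))) (ℤ.pos-* n b))) ⟩
    (+ 1 ℤ.+ + m ℤ.* + n) ℤ.* + b ℤ.- + m ℤ.* (+ n ℤ.* + b)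
      ≡⟨ collapse (+ m) (+ n) (+ b) ⟩
    + b
      ≡⟨ cong (λ N → + (N C n)) (total m j) ⟩
    + (((m + 1) * n) C n) ∎
    where
    a = (suc (m * n) + j) C j
    b = (suc (m * n) + j) C n
    expand : ∀ s b m a → s ℤ.* (b ℤ.- m ℤ.* a) ≡ s ℤ.* b ℤ.- m ℤ.* (s ℤ.* a)
    expand = ℤSolver.solve-∀
    collapse : ∀ m n b → (+ 1 ℤ.+ m ℤ.* n) ℤ.* b ℤ.- m ℤ.* (n ℤ.* b) ≡ b
    collapse = ℤSolver.solve-∀
    total : ∀ m j → suc (m * suc j) + j ≡ (m + 1) * suc j
    total = ℕSolver.solve-∀

  completionCount-partialSums : ∀ l r →
    PartialSums (λ q → + completionCount l r q) (λ q → + descendingCount l r q)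
  completionCount-partialSums l r .first  = refl
  completionCount-partialSums l r .next q = refl

  ballot-boundary′ : ∀ {x y} → x + 1 ≡ m * suc y → ballot (suc x) (suc y) ≡ + 0
  ballot-boundary′ {x} {y} eq =
    trans (cong (λ N → ballot N (suc y)) (trans (+-comm 1 x) eq)) (ballot-boundary y)

  mutual
    -- `L` is the number of letters above `l`, and the hypothesis says that `x` is the current
    -- column. The term of index `y` multiplies the arrivals at height `y` by the continuations with
    -- `L - y` leftovers. Every path is counted once, so the sum is the same for all columns; the
    -- induction moves on to the next one.
    convolution-completionCount : ∀ l r L x → x + suc r ≡ m * suc L →
      convolution (ballot x) (λ q → + completionCount l r q) L
        ≡ ballot (suc (m * (l + suc L))) (l + suc L)
    -- The vertical steps within the column pass from the second factor to the first: arrivals times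
    -- continuations become paths times horizontal departures.
    convolution-completionCount l r L x eq = trans
      (convolution-summation (ballot-partialSums x) (completionCount-partialSums l r) L)
      (convolution-descendingCount l r L x eq)

    convolution-descendingCount : ∀ l r L x → x + suc r ≡ m * suc L →
      convolution (ballot (suc x)) (λ q → + descendingCount l r q) L
        ≡ ballot (suc (m * (l + suc L))) (l + suc L)
    convolution-descendingCount l (suc r) L x eq =
      convolution-completionCount l r L (suc x) (trans (sym (+-suc x (suc r))) eq)
    -- In the last column only vertical steps remain. The missing term of index `suc L` is a
    -- boundary value, hence zero.
    convolution-descendingCount zero zero L x eq = begin
      convolution (ballot (suc x)) (const (+ 1)) L
        ≡⟨ partialSums-unique (partialSums-convolution-1 _) (ballot-partialSums (suc x)) L ⟩
      ballot (2 + x) L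
        ≡⟨ ℤ.+-identityʳ _ ⟨
      ballot (2 + x) L ℤ.+ + 0
        ≡⟨ cong (λ c → ballot (2 + x) L ℤ.+ c) (ballot-boundary′ eq) ⟨
      ballot (2 + x) L ℤ.+ ballot (suc x) (suc L)
        ≡⟨ ballot-partialSums (suc x) .next L ⟨
      ballot (2 + x) (suc L)
        ≡⟨ cong (λ N → ballot (suc N) (suc L)) (trans (+-comm 1 x) eq) ⟩
      ballot (suc (m * suc L)) (suc L) ∎
    -- By definition `descendingCount (suc l) zero q` is `A (suc q)`. The longer convolution that
    -- the next column needs has one further term, with factor `A 0`, and its weight is a boundary
    -- value.
    convolution-descendingCount (suc l) zero L x eq = begin
      convolution (ballot (suc x)) (A ∘ suc) L
        ≡⟨ ℤ.+-identityʳ _ ⟨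
      convolution (ballot (suc x)) (A ∘ suc) L ℤ.+ + 0
        ≡⟨ cong (λ c → convolution (ballot (suc x)) (A ∘ suc) L ℤ.+ c ℤ.* A 0) (ballot-boundary′ eq) ⟨
      convolution (ballot (suc x)) (A ∘ suc) L ℤ.+ ballot (suc x) (suc L) ℤ.* A 0
        ≡⟨ convolution-unfoldʳ (ballot (suc x)) A L ⟨
      convolution (ballot (suc x)) A (suc L)
        ≡⟨ convolution-completionCount l k (suc L) (suc x) eq′ ⟩
      ballot (suc (m * (l + suc (suc L)))) (l + suc (suc L))
        ≡⟨ cong (λ n → ballot (suc (m * n)) n) (+-suc l (suc L)) ⟩
      ballot (suc (m * (suc l + suc L))) (suc l + suc L) ∎
      where
      A : ℕ → ℤ
      A q = + completionCount l k q
      eq′ : suc x + m ≡ m * (2 + L)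
      eq′ = trans (cong (_+ m) (trans (+-comm 1 x) eq)) (trans (+-comm _ m) (sym (*-suc m (suc L))))

  length-arrangements : ∀ n → + length (arrangements n) ≡ ballot (suc (m * n)) n
  length-arrangements zero    = refl
  length-arrangements (suc l) = begin
    + length (completions l k [])
      ≡⟨ cong +_ (length-completions l k []) ⟩
    + completionCount l k 0
      -- The start is column 0 with no letter above `l`; the convolution is the single product with
      -- `ballot 0 0`, which is 1.
      ≡⟨ ℤ.*-identityˡ _ ⟨
    + 1 ℤ.* + completionCount l k 0
      ≡⟨ convolution-completionCount l k 0 0 (sym (*-identityʳ m)) ⟩
    ballot (suc (m * (l + 1))) (l + 1)
      ≡⟨ cong (λ n → ballot (suc (m * n)) n) (+-comm l 1) ⟩
    ballot (suc (m * suc l)) (suc l) ∎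

  fussCatalan : ∀ n → suc (m * n) * length (arrangements n) ≡ ((m + 1) * n) C n
  fussCatalan n = ℤ.+-injective (begin
    + (suc (m * n) * length (arrangements n))
      ≡⟨ ℤ.pos-* (suc (m * n)) _ ⟩
    + suc (m * n) ℤ.* + length (arrangements n)
      ≡⟨ cong (λ c → + suc (m * n) ℤ.* c) (length-arrangements n) ⟩
    + suc (m * n) ℤ.* ballot (suc (m * n)) n
      ≡⟨ ballot-diagonal n ⟩
    + (((m + 1) * n) C n) ∎)

-- Pattern avoidance and admissibility.

π₁₂₂ π₁₂₃ : Pattern
π₁₂₂ = 1 ∷ 2 ∷ 2 ∷ []
π₁₂₃ = 1 ∷ 2 ∷ 3 ∷ []

letters : ∀ {n} → Word n → List ℕ
letters = map toℕ

module _ {n : ℕ} where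

  same-< : ∀ {a b : Fin n} {p q} → a Fin.< b → p < q → SameComparison (a , p) (b , q)
  same-< a<b p<q =
      mk⇔ (const p<q) (const a<b)
    , mk⇔ (λ a≡b → contradiction a≡b (Fin.<⇒≢ a<b)) (λ p≡q → contradiction p≡q (<⇒≢ p<q))

  same-≡ : ∀ {a b : Fin n} {p q} → a ≡ b → p ≡ q → SameComparison (a , p) (b , q)
  same-≡ a≡b p≡q =
      mk⇔ (λ a<b → contradiction a≡b (Fin.<⇒≢ a<b)) (λ p<q → contradiction p≡q (<⇒≢ p<q))
    , mk⇔ (const p≡q) (const a≡b)

  avoids-tail : ∀ {π a} {w : Word n} → Avoids π (a ∷ w) → Avoids π w
  avoids-tail av (v , v⊆w , v≅π) = av (v , _ ∷ʳ v⊆w , v≅π)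

  ⊆⇒allPairs : {R : Fin n → Fin n → Set} (w : Word n) →
               (∀ {x y} → x ∷ y ∷ [] ⊆ w → R x y) → AllPairs R w
  ⊆⇒allPairs []      f = []
  ⊆⇒allPairs (x ∷ w) f =
    All.tabulate (λ y∈w → f (refl ∷ from∈ y∈w)) ∷ ⊆⇒allPairs w (λ s → f (x ∷ʳ s))

  -- After `a`, let `x` with `a < x` be followed by `y`: then `y = x` would complete 122 and `y > x`
  -- would complete 123.
  avoids⇒admissible : ∀ (w : Word n) → Avoids π₁₂₂ w → Avoids π₁₂₃ w → Admissible (letters w)
  avoids⇒admissible []      _   _   = tt
  avoids⇒admissible (a ∷ w) 122∉ 123∉ =
      AllPairs.map⁺ (⊆⇒allPairs w decreasing)
    , avoids⇒admissible w (avoids-tail 122∉) (avoids-tail 123∉)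
    where
    decreasing : ∀ {x y} → x ∷ y ∷ [] ⊆ w → a Fin.< x → y Fin.< x
    decreasing {x} {y} s a<x with Fin.<-cmp x y
    ... | tri> _ _ y<x = y<x
    ... | tri≈ _ x≡y _ = contradiction
      (_ , refl ∷ s , refl ,
        (same-< a<x (s≤s (s≤s z≤n)) ∷ same-< (subst (a Fin.<_) x≡y a<x) (s≤s (s≤s z≤n)) ∷ []) ∷
        (same-≡ x≡y refl ∷ []) ∷ [] ∷ []) 122∉
    ... | tri< x<y _ _ = contradiction
      (_ , refl ∷ s , refl ,
        (same-< a<x (s≤s (s≤s z≤n)) ∷ same-< (Fin.<-trans a<x x<y) (s≤s (s≤s z≤n)) ∷ []) ∷
        (same-< x<y (s≤s (s≤s (s≤s z≤n))) ∷ []) ∷ [] ∷ []) 123∉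

  allPairs⇒⊆ : ∀ {R : Fin n → Fin n → Set} {x y w} → AllPairs R w → x ∷ y ∷ [] ⊆ w → R x y
  allPairs⇒⊆ (_ ∷ ps) (_ ∷ʳ s)   = allPairs⇒⊆ ps s
  allPairs⇒⊆ (p ∷ _)  (refl ∷ s) = All.lookup p (to∈ s)

  admissible⇒decreasing : ∀ {a b c} {w : Word n} → a ∷ b ∷ c ∷ [] ⊆ w → Admissible (letters w) →
                          a Fin.< b → c Fin.< b
  admissible⇒decreasing (_ ∷ʳ s)   (_ , adm) = admissible⇒decreasing s adm
  admissible⇒decreasing (refl ∷ s) (dec , _) = allPairs⇒⊆ (AllPairs.map⁻ dec) s

  admissible⇒avoids₁₂₂ : ∀ (w : Word n) → Admissible (letters w) → Avoids π₁₂₂ w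
  admissible⇒avoids₁₂₂ w adm (a ∷ b ∷ c ∷ [] , s , refl , (ab ∷ _) ∷ (bc ∷ _) ∷ _) =
    Fin.<⇒≢ (admissible⇒decreasing s adm (Equivalence.from (proj₁ ab) (s≤s (s≤s z≤n))))
            (sym (Equivalence.from (proj₂ bc) refl))

  admissible⇒avoids₁₂₃ : ∀ (w : Word n) → Admissible (letters w) → Avoids π₁₂₃ w
  admissible⇒avoids₁₂₃ w adm (a ∷ b ∷ c ∷ [] , s , refl , (ab ∷ _) ∷ (bc ∷ _) ∷ _) =
    <-asym (admissible⇒decreasing s adm (Equivalence.from (proj₁ ab) (s≤s (s≤s z≤n))))
           (Equivalence.from (proj₁ bc) (s≤s (s≤s (s≤s z≤n))))

  -- Letter counts and rearrangements.

  occurrences-∷⁻ : ∀ {a x} (v w : Word n) → occurrences a (x ∷ v) ≡ occurrences a (x ∷ w) →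
                   occurrences a v ≡ occurrences a w
  occurrences-∷⁻ {a} {x} v w eq with a Fin.≟ x
  ... | yes _ = suc-injective eq
  ... | no  _ = eq

  occurrences-head : ∀ x (w : Word n) → occurrences x (x ∷ w) ≡ suc (occurrences x w)
  occurrences-head x w = cong length (filter-accept (x Fin.≟_) refl)

  occurrences⇒∈ : ∀ {x c} (w : Word n) → occurrences x w ≡ suc c → x ∈ w
  occurrences⇒∈ {x} w eq with filter (x Fin.≟_) w in filter≡
  ... | y ∷ _ with y∈w , refl ← ∈-filter⁻ (x Fin.≟_) {xs = w} (subst (y ∈_) (sym filter≡) (here refl)) =
    y∈w

  -- The head of the first word occurs in the second; removing it from both leaves equal counts.
  occurrences⇒↭ : ∀ (v w : Word n) → (∀ a → occurrences a v ≡ occurrences a w) → v ↭ w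
  occurrences⇒↭ []      []      _  = ↭-refl
  occurrences⇒↭ []      (x ∷ w) eq with () ← trans (eq x) (occurrences-head x w)
  occurrences⇒↭ (x ∷ v) w       eq
    with ys , zs , refl ← ∈-∃++ (occurrences⇒∈ w (trans (sym (eq x)) (occurrences-head x v))) =
    ↭-trans (prep x (occurrences⇒↭ v (ys ++ zs) λ a → occurrences-∷⁻ v (ys ++ zs)
              (trans (eq a) (↭-length (filter-↭ (a Fin.≟_) (shift x ys zs))))))
            (↭-sym (shift x ys zs))

  occurrences-letters : ∀ a (w : Word n) →
                        length (filter (toℕ a ≟_) (letters w)) ≡ occurrences a w
  occurrences-letters a []      = refl
  occurrences-letters a (x ∷ w) with a Fin.≟ x
  ... | yes refl = trans (cong length (filter-accept (toℕ a ≟_) {xs = letters w} refl))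
                         (cong suc (occurrences-letters a w))
  ... | no  a≢x  = trans (cong length (filter-reject (toℕ a ≟_) {xs = letters w}
                                                   (a≢x ∘ Fin.toℕ-injective)))
                         (occurrences-letters a w)

  letters-surjective : ∀ {v} → All (_< n) v → ∃[ w ] letters {n} w ≡ v
  letters-surjective []          = [] , refl
  letters-surjective (x<n ∷ v<n) with w , refl ← letters-surjective v<n =
    fromℕ< x<n ∷ w , cong (_∷ letters w) (Fin.toℕ-fromℕ< x<n)

-- From the listed multipermutations to the arrangements.

words-unique : ∀ n k → Unique (words n k)
words-unique n zero    = [] ∷ []
words-unique n (suc k) =
  Unique.cartesianProductWith⁺ _∷_ ∷-injective (Unique.allFin⁺ n) (words-unique n k)

∈-words : ∀ {n} (w : Word n) → w ∈ words n (length w)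
∈-words []      = here refl
∈-words (a ∷ w) = ∈-cartesianProductWith⁺ _∷_ (∈-allFin a) (∈-words w)

unique∧set⇒length : ∀ {A : Set} {xs ys : List A} → Unique xs → Unique ys →
  (∀ {x} → x ∈ xs → x ∈ ys) → (∀ {x} → x ∈ ys → x ∈ xs) → length xs ≡ length ys
unique∧set⇒length xs! ys! to from = ↭-length (∼bag⇒↭ (unique∧set⇒bag xs! ys! (mk⇔ to from)))

module Multipermutations (k : ℕ) where

  open Enumeration k
  open Counting k using (m; fussCatalan)

  length-copies : ∀ n → length (copies n) ≡ n * m
  length-copies zero    = refl
  length-copies (suc l) = trans (length-++ (replicate m l))
                                (cong₂ _+_ (length-replicate m) (length-copies l))

  occurrences-copies : ∀ n {a} → a < n → length (filter (a ≟_) (copies n)) ≡ m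
  occurrences-copies (suc l) {a} a<n = trans
    (trans (cong length (filter-++ (a ≟_) (replicate m l) (copies l)))
           (length-++ (filter (a ≟_) (replicate m l))))
    (split (m<1+n⇒m<n∨m≡n a<n))
    where
    split : a < l ⊎ a ≡ l →
      length (filter (a ≟_) (replicate m l)) + length (filter (a ≟_) (copies l)) ≡ m
    split (inj₁ a<l) =
      cong₂ _+_ (cong length (filter-none (a ≟_) (All.replicate⁺ m (<⇒≢ a<l))))
                (occurrences-copies l a<l)
    split (inj₂ refl) = trans
      (cong₂ _+_ (trans (cong length (filter-all (a ≟_) (All.replicate⁺ m refl))) (length-replicate m))
                 (cong length (filter-none (a ≟_) (All.map (λ x<a → <⇒≢ x<a ∘ sym) (copies-< a)))))
      (+-identityʳ m)

  copies⇒isMultipermutation : ∀ {n} (w : Word n) → letters w ↭ copies n → IsMultipermutation n m w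
  copies⇒isMultipermutation {n} w w↭ =
      trans (sym (length-map toℕ w)) (trans (↭-length w↭) (length-copies n))
    , λ a → trans (sym (occurrences-letters a w))
           (trans (↭-length (filter-↭ (toℕ a ≟_) w↭)) (occurrences-copies n (Fin.toℕ<n a)))

  -- Some word `v` spells `copies n` and is itself a multipermutation, so `w` and `v` have equal
  -- letter counts.
  isMultipermutation⇒copies : ∀ {n} (w : Word n) → IsMultipermutation n m w → letters w ↭ copies n
  isMultipermutation⇒copies {n} w (_ , w-occ) with v , v≡ ← letters-surjective (copies-< n) =
    ↭-trans (map⁺ toℕ (occurrences⇒↭ w v λ a → trans (w-occ a) (sym (v-occ a)))) (↭-reflexive v≡)
    where
    v-occ = proj₂ (copies⇒isMultipermutation v (↭-reflexive v≡))

  -- Two lists without repetition and with the same members have equal length; injectivity of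
  -- `letters` keeps the avoiders distinct.
  s≡length-arrangements : ∀ n → s n m (π₁₂₂ ∷ π₁₂₃ ∷ []) ≡ length (arrangements n)
  s≡length-arrangements n = trans (sym (length-map letters avoiders))
    (unique∧set⇒length (Unique.map⁺ (map-injective Fin.toℕ-injective) avoiders-unique)
                       (arrangements-unique n) to from)
    where
    Π = π₁₂₂ ∷ π₁₂₃ ∷ []
    avoiders = filter (avoidsAll? Π) (multipermutations n m)

    avoiders-unique : Unique avoiders
    avoiders-unique = Unique.filter⁺ (avoidsAll? Π)
      (Unique.filter⁺ (isMultipermutation? n m) (words-unique n (n * m)))

    to : ∀ {v} → v ∈ map letters avoiders → v ∈ arrangements n
    to v∈ with w , w∈ , refl ← ∈-map⁻ letters v∈
          with w∈′ , 122∉ ∷ 123∉ ∷ [] ← ∈-filter⁻ (avoidsAll? Π) {xs = multipermutations n m} w∈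
          with _ , multi ← ∈-filter⁻ (isMultipermutation? n m) {xs = words n (n * m)} w∈′ =
      arrangements-complete n (isMultipermutation⇒copies w multi) (avoids⇒admissible w 122∉ 123∉)

    from : ∀ {v} → v ∈ arrangements n → v ∈ map letters avoiders
    from v∈ with v↭ , adm ← arrangements-sound n v∈
            with w , refl ← letters-surjective (All-resp-↭ (↭-sym v↭) (copies-< n)) =
      ∈-map⁺ letters (∈-filter⁺ (avoidsAll? Π)
        (∈-filter⁺ (isMultipermutation? n m)
                    (subst (λ N → w ∈ words n N) (proj₁ multi) (∈-words w)) multi)
        (admissible⇒avoids₁₂₂ w adm ∷ admissible⇒avoids₁₂₃ w adm ∷ []))
      where multi = copies⇒isMultipermutation w v↭

  s-fussCatalan : ∀ n → suc (m * n) * s n m (π₁₂₂ ∷ π₁₂₃ ∷ []) ≡ ((m + 1) * n) C n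
  s-fussCatalan n = trans (cong (suc (m * n) *_) (s≡length-arrangements n)) (fussCatalan n)

-- The formula over the rationals.

-- This is the cross multiplication that `*≡*` demands: `suc d * 1` is the denominator of the
-- product, and the last factor 1 is that of `a`.
/-cross : ∀ d a b → suc d * a ≡ b → + a ℤ.* + (suc d * 1) ≡ + 1 ℤ.* + b ℤ.* + 1
/-cross d a b eq = begin
  + a ℤ.* + (suc d * 1) ≡⟨ cong (λ e → + a ℤ.* + e) (*-identityʳ (suc d)) ⟩
  + a ℤ.* + suc d       ≡⟨ ℤ.pos-* a (suc d) ⟨
  + (a * suc d)         ≡⟨ cong +_ (trans (*-comm a (suc d)) eq) ⟩
  + b                   ≡⟨ trans (ℤ.*-identityʳ _) (ℤ.*-identityˡ (+ b)) ⟨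
  + 1 ℤ.* + b ℤ.* + 1   ∎

*≡⇒≡/* : ∀ d a b → suc d * a ≡ b → + a / 1 ≡ (+ 1 / suc d) *ℚ (+ b / 1)
*≡⇒≡/* d a b eq = ℚ.toℚᵘ-injective
  (ℚᵘ.≃-trans (ℚ.toℚᵘ-fromℚᵘ a′)
  (ℚᵘ.≃-trans (*≡* (/-cross d a b eq))
  (ℚᵘ.≃-sym (ℚᵘ.≃-trans (ℚ.toℚᵘ-homo-* (fromℚᵘ d′) (fromℚᵘ b′))
                        (ℚᵘ.*-cong (ℚ.toℚᵘ-fromℚᵘ d′) (ℚ.toℚᵘ-fromℚᵘ b′))))))
  where
  -- The second argument of `mkℚᵘ` is the denominator minus one.
  a′ = mkℚᵘ (+ a) 0
  b′ = mkℚᵘ (+ b) 0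
  d′ = mkℚᵘ (+ 1) d

theorem4 : ∀ (m n : ℕ) → m ≥ 1 →
    + s n m ((1 ∷ 2 ∷ 2 ∷ []) ∷ (1 ∷ 2 ∷ 3 ∷ []) ∷ []) / 1
    ≡ (+ 1 / suc (m * n)) *ℚ (+ (((m + 1) * n) C n) / 1)
theorem4 (suc k) n _ = *≡⇒≡/* (suc k * n) _ _ (Multipermutations.s-fussCatalan k n)
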